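{- Let $A$ be a set of atoms. For all terms $s,t$ (possibly containing variables) over the signature $\Sigma^{\mathsf U}_{\mathrm{SCL}}(A)=\{\wedge,\vee,\neg,\mathsf T,\mathsf F,\mathsf U\}\cup A$, $$\mathrm{CL}_3\vdash s=t\iff \mathrm{C\ell SCL}\vdash s=t.$$
   Context: $\vdash$ denotes derivability in equational logic (variables in axioms may be instantiated by arbitrary terms). Here $\wedge,\vee$ are binary symbols for the (noncommutative) short-circuit conjunction and disjunction, $\neg$ is unary, and $\mathsf T,\mathsf F,\mathsf U$ and all atoms $a\in A$ are constants. $\mathrm{CL}_3$ is the equational theory with the axioms: (a) $\neg\neg x=x$; (b) $\neg(x\wedge y)=\neg x\vee\neg y$; (c) $(x\wedge y)\wedge z=x\wedge(y\wedge z)$; (d) $x\wedge(y\vee z)=(x\wedge y)\vee(x\wedge z)$; (e) $(x\vee y)\wedge z=(x\wedge z)\vee(\neg x\wedge y\wedge z)$ (bracketing immaterial by (c)); (f) $x\vee(x\wedge y)=x$; (g) $(x\wedge y)\vee(y\wedge x)=(y\wedge x)\vee(x\wedge y)$; together with $\mathsf T\wedge x=x$, $\neg\mathsf T=\mathsf F$ and $\neg\mathsf U=\mathsf U$. The ternary conditional is written $x\lhd y\rhd z$ ("if $y$ then $x$ else $z$"). $\mathrm{CP}$ consists of: $x\lhd\mathsf T\rhd y=x$; $x\lhd\mathsf F\rhd y=y$; $\mathsf T\lhd x\rhd\mathsf F=x$; $x\lhd(y\lhd z\rhd u)\rhd v=(x\lhd y\rhd v)\lhd z\rhd(x\lhd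 u\rhd v)$. $\mathrm{CP}_{mem}$ is $\mathrm{CP}$ plus $x\lhd y\rhd(z\lhd u\rhd(v\lhd y\rhd w))=x\lhd y\rhd(z\lhd u\rhd w)$. $\mathrm{CP}_{cl}$ is $\mathrm{CP}_{mem}$ plus $(x\lhd y\rhd z)\lhd u\rhd(v\lhd y\rhd w)=(x\lhd u\rhd v)\lhd y\rhd(z\lhd u\rhd w)$. $\mathrm{CP}_{cl}^{\mathsf U}$ is $\mathrm{CP}_{cl}$ plus $x\lhd\mathsf U\rhd y=\mathsf U$. $\mathrm{C\ell SCL}$ (conditional short-circuit logic with undefinedness) is the set of consequences, restricted to the signature without the conditional, of $\mathrm{CP}_{cl}^{\mathsf U}\cup\{\neg x=\mathsf F\lhd x\rhd\mathsf T,\ x\wedge y=y\lhd x\rhd\mathsf F\}$, where additionally $\mathsf F=\neg\mathsf T$ and $x\vee y=\neg(\neg x\wedge\neg y)$. That is, for terms $s,t$ over $\Sigma^{\mathsf U}_{\mathrm{SCL}}(A)$, $\mathrm{C\ell SCL}\vdash s=t$ means that $s=t$ is derivable from all these equations in the combined signature. -}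

module Defs where

open import Data.Nat.Base using (ℕ)
open import Data.Vec.Base using (Vec; []; _∷_)
open import Data.Vec.Relation.Binary.Pointwise.Inductive using (Pointwise)
open import Level using (Level; suc; _⊔_)
open import Relation.Binary.Core using (Rel)

private
  variable
    a ℓ : Level

record Signature (a : Level) : Set (suc a) where
  field
    Op : ℕ → Set a      -- Op n: the symbols of arity n

open Signature public

-- Terms may contain variables from a countably infinite supply.
data Term (Σ : Signature a) : Set a where
  var : ℕ → Term Σ
  op  : ∀ {n} → Op Σ n → Vec (Term Σ) n → Term Σ

module _ {Σ : Signature a} where

  mutual
    _[_] : Term Σ → (ℕ → Term Σ) → Term Σ
    var i   [ σ ] = σ i
    op f ts [ σ ] = op f (ts [ σ ]*)

    _[_]* : ∀ {n} → Vec (Term Σ) n → (ℕ → Term Σ) → Vec (Term Σ) n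
    []       [ σ ]* = []
    (t ∷ ts) [ σ ]* = (t [ σ ]) ∷ (ts [ σ ]*)

module _ {Σ Σ′ : Signature a} (φ : ∀ {n} → Op Σ n → Op Σ′ n) where

  mutual
    rename : Term Σ → Term Σ′
    rename (var i)   = var i
    rename (op f ts) = op (φ f) (rename* ts)

    rename* : ∀ {n} → Vec (Term Σ) n → Vec (Term Σ′) n
    rename* []       = []
    rename* (t ∷ ts) = rename t ∷ rename* ts

infix 1 _⊢_≈_

data _⊢_≈_ {Σ : Signature a} (E : Rel (Term Σ) ℓ) :
           Term Σ → Term Σ → Set (a ⊔ ℓ) where
  axiom : ∀ {s t} → E s t → (σ : ℕ → Term Σ) → E ⊢ s [ σ ] ≈ t [ σ ]
  refl  : ∀ {t} → E ⊢ t ≈ t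
  sym   : ∀ {s t} → E ⊢ s ≈ t → E ⊢ t ≈ s
  trans : ∀ {s t u} → E ⊢ s ≈ t → E ⊢ t ≈ u → E ⊢ s ≈ u
  cong  : ∀ {n} (f : Op Σ n) {ss ts : Vec (Term Σ) n} →
          Pointwise (E ⊢_≈_) ss ts → E ⊢ op f ss ≈ op f ts

module Variables where

  pattern x = var 0
  pattern y = var 1
  pattern z = var 2
  pattern u = var 3
  pattern v = var 4
  pattern w = var 5

data SCLOp (A : Set a) : ℕ → Set a where
  true false undef : SCLOp A 0
  atom             : A → SCLOp A 0
  not              : SCLOp A 1
  and or           : SCLOp A 2

ΣSCLᵁ : Set a → Signature a
ΣSCLᵁ A = record { Op = SCLOp A }

module SCLSyntax where

  infix  8 ¬_
  infixr 7 _∧_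
  infixr 6 _∨_

  pattern T       = op true []
  pattern F       = op false []
  pattern U       = op undef []
  pattern ¬_ p    = op not (p ∷ [])
  pattern _∧_ p q = op and (p ∷ q ∷ [])
  pattern _∨_ p q = op or (p ∷ q ∷ [])

module _ {A : Set a} where

  open SCLSyntax
  open Variables

  data CL₃ : Rel (Term (ΣSCLᵁ A)) a where
    ¬-invol  : CL₃ (¬ ¬ x) x
    deMorgan : CL₃ (¬ (x ∧ y)) (¬ x ∨ ¬ y)
    ∧-assoc  : CL₃ ((x ∧ y) ∧ z) (x ∧ (y ∧ z))
    ∧-distˡ  : CL₃ (x ∧ (y ∨ z)) ((x ∧ y) ∨ (x ∧ z))
    ∧-distʳ  : CL₃ ((x ∨ y) ∧ z) ((x ∧ z) ∨ (¬ x ∧ (y ∧ z)))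
    ∨-absorb : CL₃ (x ∨ (x ∧ y)) x
    ∧∨-comm  : CL₃ ((x ∧ y) ∨ (y ∧ x)) ((y ∧ x) ∨ (x ∧ y))
    T-∧      : CL₃ (T ∧ x) x
    ¬T       : CL₃ (¬ T) F
    ¬U       : CL₃ (¬ U) U

data CondOp (A : Set a) : ℕ → Set a where
  scl  : ∀ {n} → SCLOp A n → CondOp A n
  cond : CondOp A 3

ΣCond : Set a → Signature a
ΣCond A = record { Op = CondOp A }

module CondSyntax where

  infix  8 ¬_
  infixr 7 _∧_
  infixr 6 _∨_
  infix  5 _◁_▷_

  pattern T           = op (scl true) []
  pattern F           = op (scl false) []
  pattern U           = op (scl undef) []
  pattern ¬_ p        = op (scl not) (p ∷ [])
  pattern _∧_ p q     = op (scl and) (p ∷ q ∷ [])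
  pattern _∨_ p q     = op (scl or) (p ∷ q ∷ [])
  -- If q then p else r: the condition is the middle argument.
  pattern _◁_▷_ p q r = op cond (p ∷ q ∷ r ∷ [])

module _ {A : Set a} where

  open CondSyntax
  open Variables

  data CP : Rel (Term (ΣCond A)) a where
    cond-T    : CP (x ◁ T ▷ y) x
    cond-F    : CP (x ◁ F ▷ y) y
    T-cond-F  : CP (T ◁ x ▷ F) x
    cond-cond : CP (x ◁ (y ◁ z ▷ u) ▷ v)
                   ((x ◁ y ▷ v) ◁ z ▷ (x ◁ u ▷ v))

  data CPmem : Rel (Term (ΣCond A)) a where
    cp  : ∀ {s t} → CP s t → CPmem s t
    mem : CPmem (x ◁ y ▷ (z ◁ u ▷ (v ◁ y ▷ w)))
                (x ◁ y ▷ (z ◁ u ▷ w))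

  data CPcl : Rel (Term (ΣCond A)) a where
    cpmem : ∀ {s t} → CPmem s t → CPcl s t
    cl    : CPcl ((x ◁ y ▷ z) ◁ u ▷ (v ◁ y ▷ w))
                 ((x ◁ u ▷ v) ◁ y ▷ (z ◁ u ▷ w))

  data CPclᵁ : Rel (Term (ΣCond A)) a where
    cpcl   : ∀ {s t} → CPcl s t → CPclᵁ s t
    cond-U : CPclᵁ (x ◁ U ▷ y) U

  data CPclᵁ+Defs : Rel (Term (ΣCond A)) a where
    cpclᵁ : ∀ {s t} → CPclᵁ s t → CPclᵁ+Defs s t
    ¬-def : CPclᵁ+Defs (¬ x) (F ◁ x ▷ T)
    ∧-def : CPclᵁ+Defs (x ∧ y) (y ◁ x ▷ F)
    F-def : CPclᵁ+Defs F (¬ T)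
    ∨-def : CPclᵁ+Defs (x ∨ y) (¬ (¬ x ∧ ¬ y))

  infix 1 CℓSCL⊢_≈_

  CℓSCL⊢_≈_ : Term (ΣSCLᵁ A) → Term (ΣSCLᵁ A) → Set a
  CℓSCL⊢ s ≈ t = CPclᵁ+Defs ⊢ rename scl s ≈ rename scl t

{-# OPTIONS --safe #-}

-- Both calculi axiomatise McCarthy's three-valued logic, and each interprets the other:
-- CL₃ reads x ◁ y ▷ z as (y ∧ x) ∨ (¬ y ∧ z).  Everything specific to the conditional follows
-- in CL₃ from three facts: a test is remembered, y ∧ r ∧ (p ◁ y ▷ q) = y ∧ r ∧ p; the guard
-- y ∨ ¬ y, which is U if y is and T otherwise, satisfies (y ∨ ¬ y) ∧ p = p ◁ y ▷ p; and
-- guards commute.  Conversely, in the conditional theory a connective in test position unfolds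
-- into nested tests, where the axioms mem and cl finish each case.

module Submission where

open import Level using (Level; suc; _⊔_)
open import Data.Nat.Base using (ℕ)
open import Data.Vec.Base using (Vec; []; _∷_)
open import Data.Vec.Relation.Binary.Pointwise.Inductive using (Pointwise; []; _∷_)
open import Function.Bundles using (_⇔_; mk⇔)
open import Relation.Binary.Bundles using (Setoid)
open import Relation.Binary.Core using (Rel)
open import Relation.Binary.PropositionalEquality as ≡ using (_≡_)
open import Relation.Binary.Structures using (IsEquivalence)
import Relation.Binary.Reasoning.Setoid as SetoidReasoning

private
  variable
    a c ℓ : Level

-- Algebras for the axioms of `CL₃` other than the one for `U`.

record CAlgebra c ℓ : Set (suc (c ⊔ ℓ)) where
  infix  8 ¬_
  infixr 7 _∧_
  infixr 6 _∨_
  infix  4 _≈_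
  field
    Carrier       : Set c
    _≈_           : Rel Carrier ℓ
    isEquivalence : IsEquivalence _≈_
    _∧_ _∨_       : Carrier → Carrier → Carrier
    ¬_            : Carrier → Carrier
    T F           : Carrier
    ∧-cong        : ∀ {p p′ q q′} → p ≈ p′ → q ≈ q′ → p ∧ q ≈ p′ ∧ q′
    ∨-cong        : ∀ {p p′ q q′} → p ≈ p′ → q ≈ q′ → p ∨ q ≈ p′ ∨ q′
    ¬-cong        : ∀ {p p′} → p ≈ p′ → ¬ p ≈ ¬ p′
    ¬-involutive  : ∀ p → ¬ ¬ p ≈ p
    ¬-∧           : ∀ p q → ¬ (p ∧ q) ≈ ¬ p ∨ ¬ q
    ∧-assoc       : ∀ p q r → (p ∧ q) ∧ r ≈ p ∧ (q ∧ r)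
    ∧-distribˡ    : ∀ p q r → p ∧ (q ∨ r) ≈ (p ∧ q) ∨ (p ∧ r)
    ∧-distribʳ    : ∀ p q r → (p ∨ q) ∧ r ≈ (p ∧ r) ∨ (¬ p ∧ (q ∧ r))
    ∨-absorbs-∧   : ∀ p q → p ∨ (p ∧ q) ≈ p
    ∧-∨-comm      : ∀ p q → (p ∧ q) ∨ (q ∧ p) ≈ (q ∧ p) ∨ (p ∧ q)
    ∧-identityˡ   : ∀ p → T ∧ p ≈ p
    ¬T≈F          : ¬ T ≈ F

  setoid : Setoid c ℓ
  setoid = record { isEquivalence = isEquivalence }

  open IsEquivalence isEquivalence public

  ∧-congˡ : ∀ {p q q′} → q ≈ q′ → p ∧ q ≈ p ∧ q′
  ∧-congˡ = ∧-cong refl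

  ∧-congʳ : ∀ {p p′ q} → p ≈ p′ → p ∧ q ≈ p′ ∧ q
  ∧-congʳ e = ∧-cong e refl

  ∨-congˡ : ∀ {p q q′} → q ≈ q′ → p ∨ q ≈ p ∨ q′
  ∨-congˡ = ∨-cong refl

  ∨-congʳ : ∀ {p p′ q} → p ≈ p′ → p ∨ q ≈ p′ ∨ q
  ∨-congʳ e = ∨-cong e refl

-- Duality between conjunction and disjunction.

module Duality (C : CAlgebra c ℓ) where
  open CAlgebra C
  open SetoidReasoning setoid

  ¬-∨ : ∀ p q → ¬ (p ∨ q) ≈ ¬ p ∧ ¬ q
  ¬-∨ p q = begin
    ¬ (p ∨ q)          ≈⟨ ¬-cong (∨-cong (¬-involutive p) (¬-involutive q)) ⟨
    ¬ (¬ ¬ p ∨ ¬ ¬ q)  ≈⟨ ¬-cong (¬-∧ (¬ p) (¬ q)) ⟨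
    ¬ ¬ (¬ p ∧ ¬ q)    ≈⟨ ¬-involutive _ ⟩
    ¬ p ∧ ¬ q          ∎

  -- Reduces each dual law to the original one: negate both sides, push the negation inwards and
  -- apply the law to negated arguments.
  ¬-injective : ∀ {p q} → ¬ p ≈ ¬ q → p ≈ q
  ¬-injective {p} {q} e = begin
    p      ≈⟨ ¬-involutive p ⟨
    ¬ ¬ p  ≈⟨ ¬-cong e ⟩
    ¬ ¬ q  ≈⟨ ¬-involutive q ⟩
    q      ∎

  ∨-assoc : ∀ p q r → (p ∨ q) ∨ r ≈ p ∨ (q ∨ r)
  ∨-assoc p q r = ¬-injective (begin
    ¬ ((p ∨ q) ∨ r)    ≈⟨ ¬-∨ _ _ ⟩
    ¬ (p ∨ q) ∧ ¬ r    ≈⟨ ∧-congʳ (¬-∨ p q) ⟩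
    (¬ p ∧ ¬ q) ∧ ¬ r  ≈⟨ ∧-assoc _ _ _ ⟩
    ¬ p ∧ (¬ q ∧ ¬ r)  ≈⟨ ∧-congˡ (¬-∨ q r) ⟨
    ¬ p ∧ ¬ (q ∨ r)    ≈⟨ ¬-∨ _ _ ⟨
    ¬ (p ∨ (q ∨ r))    ∎)

  ∨-distribˡ : ∀ p q r → p ∨ (q ∧ r) ≈ (p ∨ q) ∧ (p ∨ r)
  ∨-distribˡ p q r = ¬-injective (begin
    ¬ (p ∨ (q ∧ r))            ≈⟨ ¬-∨ _ _ ⟩
    ¬ p ∧ ¬ (q ∧ r)            ≈⟨ ∧-congˡ (¬-∧ q r) ⟩
    ¬ p ∧ (¬ q ∨ ¬ r)          ≈⟨ ∧-distribˡ _ _ _ ⟩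
    (¬ p ∧ ¬ q) ∨ (¬ p ∧ ¬ r)  ≈⟨ ∨-cong (¬-∨ p q) (¬-∨ p r) ⟨
    ¬ (p ∨ q) ∨ ¬ (p ∨ r)      ≈⟨ ¬-∧ _ _ ⟨
    ¬ ((p ∨ q) ∧ (p ∨ r))      ∎)

  ∨-distribʳ : ∀ p q r → (p ∧ q) ∨ r ≈ (p ∨ r) ∧ (¬ p ∨ (q ∨ r))
  ∨-distribʳ p q r = ¬-injective (begin
    ¬ ((p ∧ q) ∨ r)                      ≈⟨ ¬-∨ _ _ ⟩
    ¬ (p ∧ q) ∧ ¬ r                      ≈⟨ ∧-congʳ (¬-∧ p q) ⟩
    (¬ p ∨ ¬ q) ∧ ¬ r                    ≈⟨ ∧-distribʳ _ _ _ ⟩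
    (¬ p ∧ ¬ r) ∨ (¬ ¬ p ∧ (¬ q ∧ ¬ r))  ≈⟨ ∨-congˡ (∧-congˡ (¬-∨ q r)) ⟨
    (¬ p ∧ ¬ r) ∨ (¬ ¬ p ∧ ¬ (q ∨ r))    ≈⟨ ∨-cong (¬-∨ p r) (¬-∨ (¬ p) (q ∨ r)) ⟨
    ¬ (p ∨ r) ∨ ¬ (¬ p ∨ (q ∨ r))        ≈⟨ ¬-∧ _ _ ⟨
    ¬ ((p ∨ r) ∧ (¬ p ∨ (q ∨ r)))        ∎)

  ∧-absorbs-∨ : ∀ p q → p ∧ (p ∨ q) ≈ p
  ∧-absorbs-∨ p q = ¬-injective (begin
    ¬ (p ∧ (p ∨ q))    ≈⟨ ¬-∧ _ _ ⟩
    ¬ p ∨ ¬ (p ∨ q)    ≈⟨ ∨-congˡ (¬-∨ p q) ⟩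
    ¬ p ∨ (¬ p ∧ ¬ q)  ≈⟨ ∨-absorbs-∧ _ _ ⟩
    ¬ p                ∎)

  ∨-∧-comm : ∀ p q → (p ∨ q) ∧ (q ∨ p) ≈ (q ∨ p) ∧ (p ∨ q)
  ∨-∧-comm p q = ¬-injective (begin
    ¬ ((p ∨ q) ∧ (q ∨ p))      ≈⟨ negate p q ⟩
    (¬ p ∧ ¬ q) ∨ (¬ q ∧ ¬ p)  ≈⟨ ∧-∨-comm _ _ ⟩
    (¬ q ∧ ¬ p) ∨ (¬ p ∧ ¬ q)  ≈⟨ negate q p ⟨
    ¬ ((q ∨ p) ∧ (p ∨ q))      ∎)
    where
    negate : ∀ p q → ¬ ((p ∨ q) ∧ (q ∨ p)) ≈ (¬ p ∧ ¬ q) ∨ (¬ q ∧ ¬ p)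
    negate p q = trans (¬-∧ _ _) (∨-cong (¬-∨ p q) (¬-∨ q p))

  ¬F≈T : ¬ F ≈ T
  ¬F≈T = trans (¬-cong (sym ¬T≈F)) (¬-involutive T)

  ∨-identityˡ : ∀ p → F ∨ p ≈ p
  ∨-identityˡ p = ¬-injective (begin
    ¬ (F ∨ p)  ≈⟨ ¬-∨ _ _ ⟩
    ¬ F ∧ ¬ p  ≈⟨ ∧-congʳ ¬F≈T ⟩
    T ∧ ¬ p    ≈⟨ ∧-identityˡ _ ⟩
    ¬ p        ∎)

  -- Every result about an arbitrary `CAlgebra` can be instantiated here, which yields its dual
  -- without a second proof.
  dual : CAlgebra c ℓ
  dual = record
    { isEquivalence = isEquivalence
    ; _∧_           = _∨_
    ; _∨_           = _∧_
    ; ¬_            = ¬_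
    ; T             = F
    ; F             = T
    ; ∧-cong        = ∨-cong
    ; ∨-cong        = ∧-cong
    ; ¬-cong        = ¬-cong
    ; ¬-involutive  = ¬-involutive
    ; ¬-∧           = ¬-∨
    ; ∧-assoc       = ∨-assoc
    ; ∧-distribˡ    = ∨-distribˡ
    ; ∧-distribʳ    = ∨-distribʳ
    ; ∨-absorbs-∧   = ∧-absorbs-∨
    ; ∧-∨-comm      = ∨-∧-comm
    ; ∧-identityˡ   = ∨-identityˡ
    ; ¬T≈F          = ¬F≈T
    }

-- Idempotence, units and memory.

module Properties (C : CAlgebra c ℓ) where
  open CAlgebra C
  open Duality C
  open SetoidReasoning setoid

  ∨-idem : ∀ p → p ∨ p ≈ p
  ∨-idem p = begin
    p ∨ p            ≈⟨ ∨-congˡ (∧-absorbs-∨ p p) ⟨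
    p ∨ p ∧ (p ∨ p)  ≈⟨ ∨-absorbs-∧ _ _ ⟩
    p                ∎

  ∧-idem : ∀ p → p ∧ p ≈ p
  ∧-idem p = begin
    p ∧ p            ≈⟨ ∧-congˡ (∨-absorbs-∧ p p) ⟨
    p ∧ (p ∨ p ∧ p)  ≈⟨ ∧-absorbs-∨ _ _ ⟩
    p                ∎

  ∧-zeroˡ : ∀ p → F ∧ p ≈ F
  ∧-zeroˡ p = begin
    F ∧ p        ≈⟨ ∧-congˡ (∨-identityˡ p) ⟨
    F ∧ (F ∨ p)  ≈⟨ ∧-absorbs-∨ F p ⟩
    F            ∎

  -- Since `∨` is not commutative, the left identity does not transfer directly. The dual of the
  -- commutativity axiom at `p` and `F` gives `below`, and absorption of that meet turns `p ∨ F`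
  -- into `(p ∨ F) ∨ p`.
  ∨-identityʳ : ∀ p → p ∨ F ≈ p
  ∨-identityʳ p = begin
    p ∨ F                  ≈⟨ ∨-absorbs-∧ _ _ ⟨
    (p ∨ F) ∨ (p ∨ F) ∧ p  ≈⟨ ∨-congˡ below ⟩
    (p ∨ F) ∨ p            ≈⟨ ∨-assoc _ _ _ ⟩
    p ∨ (F ∨ p)            ≈⟨ ∨-congˡ (∨-identityˡ p) ⟩
    p ∨ p                  ≈⟨ ∨-idem p ⟩
    p                      ∎
    where
    below : (p ∨ F) ∧ p ≈ p
    below = begin
      (p ∨ F) ∧ p        ≈⟨ ∧-congˡ (∨-identityˡ p) ⟨
      (p ∨ F) ∧ (F ∨ p)  ≈⟨ ∨-∧-comm p F ⟩
      (F ∨ p) ∧ (p ∨ F)  ≈⟨ ∧-congʳ (∨-identityˡ p) ⟩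
      p ∧ (p ∨ F)        ≈⟨ ∧-absorbs-∨ p F ⟩
      p                  ∎

  -- Write X and Y for the two sides. Absorption gives X ∨ Y ≈ X, because X ∧ q ≈ Y, and Y ∨ X ≈ Y,
  -- because X is Y ∧ p. Distributing `p` over the commutativity axiom gives X ∨ Y ≈ Y ∨ X.
  ∧-remember : ∀ p q → (p ∧ q) ∧ p ≈ p ∧ q
  ∧-remember p q = begin
    (p ∧ q) ∧ p                      ≈⟨ ∨-absorbs-∧ _ _ ⟨
    (p ∧ q) ∧ p ∨ ((p ∧ q) ∧ p) ∧ q  ≈⟨ ∨-congˡ (trans (∧-assoc _ _ _) (∧-idem _)) ⟩
    (p ∧ q) ∧ p ∨ p ∧ q              ≈⟨ ∨-cong (sym (∧-assoc _ _ _)) p∧[p∧q] ⟨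
    p ∧ (q ∧ p) ∨ p ∧ (p ∧ q)        ≈⟨ ∧-distribˡ _ _ _ ⟨
    p ∧ (q ∧ p ∨ p ∧ q)              ≈⟨ ∧-congˡ (∧-∨-comm q p) ⟩
    p ∧ (p ∧ q ∨ q ∧ p)              ≈⟨ ∧-distribˡ _ _ _ ⟩
    p ∧ (p ∧ q) ∨ p ∧ (q ∧ p)        ≈⟨ ∨-cong p∧[p∧q] (sym (∧-assoc _ _ _)) ⟩
    p ∧ q ∨ (p ∧ q) ∧ p              ≈⟨ ∨-absorbs-∧ _ _ ⟩
    p ∧ q                            ∎
    where
    p∧[p∧q] : p ∧ (p ∧ q) ≈ p ∧ q
    p∧[p∧q] = trans (sym (∧-assoc _ _ _)) (∧-congʳ (∧-idem p))

  -- Read backwards, this is `∨-distribʳ` with `F` as third argument, the occurrences of `F` being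
  -- cleared by the right identity.
  ∧-¬∨ : ∀ p q → p ∧ (¬ p ∨ q) ≈ p ∧ q
  ∧-¬∨ p q = begin
    p ∧ (¬ p ∨ q)              ≈⟨ ∧-cong (∨-identityʳ p) (∨-congˡ (∨-identityʳ q)) ⟨
    (p ∨ F) ∧ (¬ p ∨ (q ∨ F))  ≈⟨ ∨-distribʳ p q F ⟨
    p ∧ q ∨ F                  ≈⟨ ∨-identityʳ _ ⟩
    p ∧ q                      ∎

  -- The right side does not simplify to `F`: both sides are undefined when `p` is.
  ∧-¬ : ∀ p → p ∧ ¬ p ≈ p ∧ F
  ∧-¬ p = begin
    p ∧ ¬ p        ≈⟨ ∧-congˡ (∨-identityʳ (¬ p)) ⟨
    p ∧ (¬ p ∨ F)  ≈⟨ ∧-¬∨ p F ⟩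
    p ∧ F          ∎

  -- The left side is how `q ◁ p ▷ F` will be read, so this justifies the definition of `∧` by the
  -- conditional.
  ∨-¬∧F : ∀ p q → p ∧ q ∨ ¬ p ∧ F ≈ p ∧ q
  ∨-¬∧F p q = begin
    p ∧ q ∨ ¬ p ∧ F        ≈⟨ ∨-congˡ (∧-congˡ (∧-zeroˡ q)) ⟨
    p ∧ q ∨ ¬ p ∧ (F ∧ q)  ≈⟨ ∧-distribʳ p F q ⟨
    (p ∨ F) ∧ q            ≈⟨ ∧-congʳ (∨-identityʳ p) ⟩
    p ∧ q                  ∎

-- The conditional as a derived operation.

module Conditional (C : CAlgebra c ℓ) where
  open CAlgebra C
  open Duality C
  open Properties C
  open Properties dual using ()
    renaming ( ∧-zeroˡ to ∨-zeroˡ; ∨-identityʳ to ∧-identityʳ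
             ; ∧-remember to ∨-remember; ∧-¬ to ∨-¬ )
  open SetoidReasoning setoid

  infix 5 _◁_▷_

  _◁_▷_ : Carrier → Carrier → Carrier → Carrier
  p ◁ q ▷ r = q ∧ p ∨ ¬ q ∧ r

  ◁▷-cong : ∀ {p p′ q q′ r r′} → p ≈ p′ → q ≈ q′ → r ≈ r′ → (p ◁ q ▷ r) ≈ (p′ ◁ q′ ▷ r′)
  ◁▷-cong ep eq er = ∨-cong (∧-cong eq ep) (∧-cong (¬-cong eq) er)

  -- A product form of the conditional. Right distributivity splits on `q`; in the second summand
  -- `¬ q ∧ r` remembers `¬ q`, so absorption removes what the factor `¬ q ∨ p` contributes.
  ∨-∧-∨ : ∀ p q r → (q ∨ r) ∧ (¬ q ∨ p) ≈ (p ◁ q ▷ r)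
  ∨-∧-∨ p q r = begin
    (q ∨ r) ∧ (¬ q ∨ p)                      ≈⟨ ∧-distribʳ _ _ _ ⟩
    q ∧ (¬ q ∨ p) ∨ ¬ q ∧ (r ∧ (¬ q ∨ p))    ≈⟨ ∨-cong (∧-¬∨ q p) (sym (∧-assoc _ _ _)) ⟩
    q ∧ p ∨ (¬ q ∧ r) ∧ (¬ q ∨ p)            ≈⟨ ∨-congˡ (∧-distribˡ _ _ _) ⟩
    q ∧ p ∨ ((¬ q ∧ r) ∧ ¬ q ∨ (¬ q ∧ r) ∧ p)
      ≈⟨ ∨-congˡ (∨-congʳ (∧-remember _ _)) ⟩
    q ∧ p ∨ (¬ q ∧ r ∨ (¬ q ∧ r) ∧ p)        ≈⟨ ∨-congˡ (∨-absorbs-∧ _ _) ⟩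
    q ∧ p ∨ ¬ q ∧ r                          ∎

  -- Both sides are products P ∧ Q and Q ∧ P by ∨-∧-∨, and ∧-∨-comm equates them.
  ◁▷-swap : ∀ p q r → q ∧ p ∨ ¬ q ∧ r ≈ ¬ q ∧ r ∨ q ∧ p
  ◁▷-swap p q r = begin
    s ∨ t                ≈⟨ mirror s t ⟨
    (s ∨ t) ∨ (t ∨ s)    ≈⟨ ∨-cong (∨-∧-∨ p q r) flipped ⟨
    (P ∧ Q) ∨ (Q ∧ P)    ≈⟨ ∧-∨-comm P Q ⟩
    (Q ∧ P) ∨ (P ∧ Q)    ≈⟨ ∨-cong flipped (∨-∧-∨ p q r) ⟩
    (t ∨ s) ∨ (s ∨ t)    ≈⟨ mirror t s ⟩
    t ∨ s                ∎
    where
    s = q ∧ p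
    t = ¬ q ∧ r
    P = q ∨ r
    Q = ¬ q ∨ p

    mirror : ∀ s t → (s ∨ t) ∨ (t ∨ s) ≈ s ∨ t
    mirror s t = begin
      (s ∨ t) ∨ (t ∨ s)  ≈⟨ ∨-assoc _ _ _ ⟨
      ((s ∨ t) ∨ t) ∨ s  ≈⟨ ∨-congʳ (∨-assoc _ _ _) ⟩
      (s ∨ (t ∨ t)) ∨ s  ≈⟨ ∨-congʳ (∨-congˡ (∨-idem t)) ⟩
      (s ∨ t) ∨ s        ≈⟨ ∨-remember s t ⟩
      s ∨ t              ∎

    flipped : Q ∧ P ≈ t ∨ s
    flipped = begin
      (¬ q ∨ p) ∧ (q ∨ r)      ≈⟨ ∧-congˡ (∨-congʳ (¬-involutive q)) ⟨
      (¬ q ∨ p) ∧ (¬ ¬ q ∨ r)  ≈⟨ ∨-∧-∨ r (¬ q) p ⟩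
      ¬ q ∧ r ∨ ¬ ¬ q ∧ p      ≈⟨ ∨-congˡ (∧-congʳ (¬-involutive q)) ⟩
      ¬ q ∧ r ∨ q ∧ p          ∎

  ◁▷-flip : ∀ p q r → (p ◁ q ▷ r) ≈ (r ◁ ¬ q ▷ p)
  ◁▷-flip p q r = trans (◁▷-swap p q r) (∨-congˡ (∧-congʳ (sym (¬-involutive q))))

  -- Memory appends a copy of `q`, which meets `¬ q` and turns it into `F`; then the copy is removed
  -- again.
  ∧-contradict : ∀ q s → (q ∧ s) ∧ ¬ q ≈ (q ∧ s) ∧ F
  ∧-contradict q s = begin
    (q ∧ s) ∧ ¬ q        ≈⟨ ∧-congʳ (∧-remember q s) ⟨
    ((q ∧ s) ∧ q) ∧ ¬ q  ≈⟨ ∧-assoc _ _ _ ⟩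
    (q ∧ s) ∧ (q ∧ ¬ q)  ≈⟨ ∧-congˡ (∧-¬ q) ⟩
    (q ∧ s) ∧ (q ∧ F)    ≈⟨ ∧-assoc _ _ _ ⟨
    ((q ∧ s) ∧ q) ∧ F    ≈⟨ ∧-congʳ (∧-remember q s) ⟩
    (q ∧ s) ∧ F          ∎

  -- The arbitrary `s` makes room for an intervening test. The `¬ q` branch shrinks to
  -- `(q ∧ s) ∧ F`, which recombines with the other branch as `(q ∧ s) ∧ (p ∨ F)`.
  remember-T : ∀ p q r s → q ∧ (s ∧ (p ◁ q ▷ r)) ≈ q ∧ (s ∧ p)
  remember-T p q r s = begin
    q ∧ (s ∧ (q ∧ p ∨ ¬ q ∧ r))                ≈⟨ ∧-assoc _ _ _ ⟨
    (q ∧ s) ∧ (q ∧ p ∨ ¬ q ∧ r)                ≈⟨ ∧-distribˡ _ _ _ ⟩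
    (q ∧ s) ∧ (q ∧ p) ∨ (q ∧ s) ∧ (¬ q ∧ r)    ≈⟨ ∨-cong (∧-assoc _ _ _) (∧-assoc _ _ _) ⟨
    ((q ∧ s) ∧ q) ∧ p ∨ ((q ∧ s) ∧ ¬ q) ∧ r
      ≈⟨ ∨-cong (∧-congʳ (∧-remember q s)) (∧-congʳ (∧-contradict q s)) ⟩
    (q ∧ s) ∧ p ∨ ((q ∧ s) ∧ F) ∧ r
      ≈⟨ ∨-congˡ (trans (∧-assoc _ _ _) (∧-congˡ (∧-zeroˡ r))) ⟩
    (q ∧ s) ∧ p ∨ (q ∧ s) ∧ F                  ≈⟨ ∧-distribˡ _ _ _ ⟨
    (q ∧ s) ∧ (p ∨ F)                          ≈⟨ ∧-congˡ (∨-identityʳ p) ⟩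
    (q ∧ s) ∧ p                                ≈⟨ ∧-assoc _ _ _ ⟩
    q ∧ (s ∧ p)                                ∎

  remember-F : ∀ p q r s → ¬ q ∧ (s ∧ (p ◁ q ▷ r)) ≈ ¬ q ∧ (s ∧ r)
  remember-F p q r s = begin
    ¬ q ∧ (s ∧ (p ◁ q ▷ r))    ≈⟨ ∧-congˡ (∧-congˡ (◁▷-flip p q r)) ⟩
    ¬ q ∧ (s ∧ (r ◁ ¬ q ▷ p))  ≈⟨ remember-T r (¬ q) p s ⟩
    ¬ q ∧ (s ∧ r)              ∎

  select-T : ∀ p q r → q ∧ (p ◁ q ▷ r) ≈ q ∧ p
  select-T p q r = begin
    q ∧ (p ◁ q ▷ r)        ≈⟨ ∧-congˡ (∧-identityˡ _) ⟨
    q ∧ (T ∧ (p ◁ q ▷ r))  ≈⟨ remember-T p q r T ⟩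
    q ∧ (T ∧ p)            ≈⟨ ∧-congˡ (∧-identityˡ p) ⟩
    q ∧ p                  ∎

  select-F : ∀ p q r → ¬ q ∧ (p ◁ q ▷ r) ≈ ¬ q ∧ r
  select-F p q r = trans (∧-congˡ (◁▷-flip p q r)) (select-T r (¬ q) p)

  guard : Carrier → Carrier
  guard q = q ∨ ¬ q

  guard-∧ : ∀ q p → guard q ∧ p ≈ (p ◁ q ▷ p)
  guard-∧ q p = begin
    (q ∨ ¬ q) ∧ p            ≈⟨ ∧-distribʳ _ _ _ ⟩
    q ∧ p ∨ ¬ q ∧ (¬ q ∧ p)  ≈⟨ ∨-congˡ (∧-assoc _ _ _) ⟨
    q ∧ p ∨ (¬ q ∧ ¬ q) ∧ p  ≈⟨ ∨-congˡ (∧-congʳ (∧-idem (¬ q))) ⟩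
    q ∧ p ∨ ¬ q ∧ p          ∎

  -- The guard adds nothing before a conditional that tests `q` anyway: selection reduces each copy
  -- made by the split to its own branch.
  guard-∧-◁▷ : ∀ p q r → guard q ∧ (p ◁ q ▷ r) ≈ (p ◁ q ▷ r)
  guard-∧-◁▷ p q r = trans (guard-∧ q _) (∨-cong (select-T p q r) (select-F p q r))

  -- A guard is never false, so the second disjunct is never reached.
  guard-∨ : ∀ q p → guard q ∨ p ≈ guard q
  guard-∨ q p = begin
    (q ∨ ¬ q) ∨ p  ≈⟨ ∨-congʳ (∨-¬ q) ⟩
    (q ∨ T) ∨ p    ≈⟨ ∨-assoc _ _ _ ⟩
    q ∨ (T ∨ p)    ≈⟨ ∨-congˡ (∨-zeroˡ p) ⟩
    q ∨ T          ≈⟨ ∨-¬ q ⟨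
    q ∨ ¬ q        ∎

  -- By `guard-∨` each guard may be extended by the other as a second disjunct, which gives the
  -- shape of the dual commutativity axiom.
  guard-comm : ∀ p q → guard p ∧ guard q ≈ guard q ∧ guard p
  guard-comm p q = begin
    guard p ∧ guard q                          ≈⟨ ∧-cong (guard-∨ p _) (guard-∨ q _) ⟨
    (guard p ∨ guard q) ∧ (guard q ∨ guard p)  ≈⟨ ∨-∧-comm _ _ ⟩
    (guard q ∨ guard p) ∧ (guard p ∨ guard q)  ≈⟨ ∧-cong (guard-∨ q _) (guard-∨ p _) ⟩
    guard q ∧ guard p                          ∎

  -- Right distributivity would split on `q ∧ p` instead of `q`. Prefixing `guard q` forces the
  -- split on `q`, and selection simplifies both copies.
  ◁▷-∧ : ∀ p q r s → (p ◁ q ▷ r) ∧ s ≈ (p ∧ s ◁ q ▷ r ∧ s)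
  ◁▷-∧ p q r s = begin
    (p ◁ q ▷ r) ∧ s                              ≈⟨ ∧-congʳ (guard-∧-◁▷ p q r) ⟨
    (guard q ∧ (p ◁ q ▷ r)) ∧ s                  ≈⟨ ∧-assoc _ _ _ ⟩
    guard q ∧ ((p ◁ q ▷ r) ∧ s)                  ≈⟨ guard-∧ q _ ⟩
    q ∧ ((p ◁ q ▷ r) ∧ s) ∨ ¬ q ∧ ((p ◁ q ▷ r) ∧ s)
      ≈⟨ ∨-cong (∧-assoc _ _ _) (∧-assoc _ _ _) ⟨
    (q ∧ (p ◁ q ▷ r)) ∧ s ∨ (¬ q ∧ (p ◁ q ▷ r)) ∧ s
      ≈⟨ ∨-cong (∧-congʳ (select-T p q r)) (∧-congʳ (select-F p q r)) ⟩
    (q ∧ p) ∧ s ∨ (¬ q ∧ r) ∧ s                  ≈⟨ ∨-cong (∧-assoc _ _ _) (∧-assoc _ _ _) ⟩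
    q ∧ (p ∧ s) ∨ ¬ q ∧ (r ∧ s)                  ∎

  ¬-◁▷ : ∀ p q r → ¬ (p ◁ q ▷ r) ≈ (¬ p ◁ q ▷ ¬ r)
  ¬-◁▷ p q r = begin
    ¬ (q ∧ p ∨ ¬ q ∧ r)            ≈⟨ ¬-∨ _ _ ⟩
    ¬ (q ∧ p) ∧ ¬ (¬ q ∧ r)        ≈⟨ ∧-cong (¬-∧ _ _) (¬-∧ _ _) ⟩
    -- De Morgan has produced the product form of a conditional on `¬ q`.
    (¬ q ∨ ¬ p) ∧ (¬ ¬ q ∨ ¬ r)    ≈⟨ ∨-∧-∨ (¬ r) (¬ q) (¬ p) ⟩
    (¬ r ◁ ¬ q ▷ ¬ p)              ≈⟨ ◁▷-flip (¬ p) q (¬ r) ⟨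
    (¬ p ◁ q ▷ ¬ r)                ∎

  ◁▷-∨-◁▷ : ∀ p q r s t → (p ◁ q ▷ r) ∨ (s ◁ q ▷ t) ≈ (p ∨ s ◁ q ▷ r ∨ t)
  ◁▷-∨-◁▷ p q r s t = begin
    (q ∧ p ∨ ¬ q ∧ r) ∨ (q ∧ s ∨ ¬ q ∧ t)    ≈⟨ ∨-assoc _ _ _ ⟩
    q ∧ p ∨ (¬ q ∧ r ∨ (q ∧ s ∨ ¬ q ∧ t))    ≈⟨ ∨-congˡ (∨-assoc _ _ _) ⟨
    -- These two disjuncts may be exchanged because one starts with `q` and the other with `¬ q`.
    q ∧ p ∨ ((¬ q ∧ r ∨ q ∧ s) ∨ ¬ q ∧ t)    ≈⟨ ∨-congˡ (∨-congʳ (◁▷-swap s q r)) ⟨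
    q ∧ p ∨ ((q ∧ s ∨ ¬ q ∧ r) ∨ ¬ q ∧ t)    ≈⟨ ∨-congˡ (∨-assoc _ _ _) ⟩
    q ∧ p ∨ (q ∧ s ∨ (¬ q ∧ r ∨ ¬ q ∧ t))    ≈⟨ ∨-assoc _ _ _ ⟨
    (q ∧ p ∨ q ∧ s) ∨ (¬ q ∧ r ∨ ¬ q ∧ t)    ≈⟨ ∨-cong (∧-distribˡ _ _ _) (∧-distribˡ _ _ _) ⟨
    q ∧ (p ∨ s) ∨ ¬ q ∧ (r ∨ t)              ∎

  ◁T▷ : ∀ p q → (p ◁ T ▷ q) ≈ p
  ◁T▷ p q = begin
    T ∧ p ∨ ¬ T ∧ q  ≈⟨ ∨-cong (∧-identityˡ p) (∧-congʳ ¬T≈F) ⟩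
    p ∨ F ∧ q        ≈⟨ ∨-congˡ (∧-zeroˡ q) ⟩
    p ∨ F            ≈⟨ ∨-identityʳ p ⟩
    p                ∎

  ◁F▷ : ∀ p q → (p ◁ F ▷ q) ≈ q
  ◁F▷ p q = begin
    F ∧ p ∨ ¬ F ∧ q  ≈⟨ ∨-cong (∧-zeroˡ p) (∧-congʳ ¬F≈T) ⟩
    F ∨ T ∧ q        ≈⟨ ∨-identityˡ _ ⟩
    T ∧ q            ≈⟨ ∧-identityˡ q ⟩
    q                ∎

  T◁▷F : ∀ q → (T ◁ q ▷ F) ≈ q
  T◁▷F q = trans (∨-¬∧F q T) (∧-identityʳ q)

  F◁▷T : ∀ q → (F ◁ q ▷ T) ≈ ¬ q
  F◁▷T q = trans (◁▷-flip F q T) (T◁▷F (¬ q))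

  ◁◁▷▷ : ∀ p q r s t → (p ◁ (q ◁ r ▷ s) ▷ t) ≈ ((p ◁ q ▷ t) ◁ r ▷ (p ◁ s ▷ t))
  ◁◁▷▷ p q r s t = begin
    (q ◁ r ▷ s) ∧ p ∨ ¬ (q ◁ r ▷ s) ∧ t          ≈⟨ ∨-congˡ (∧-congʳ (¬-◁▷ q r s)) ⟩
    (q ◁ r ▷ s) ∧ p ∨ (¬ q ◁ r ▷ ¬ s) ∧ t        ≈⟨ ∨-cong (◁▷-∧ q r s p) (◁▷-∧ (¬ q) r (¬ s) t) ⟩
    (q ∧ p ◁ r ▷ s ∧ p) ∨ (¬ q ∧ t ◁ r ▷ ¬ s ∧ t)
      ≈⟨ ◁▷-∨-◁▷ _ _ _ _ _ ⟩
    ((p ◁ q ▷ t) ◁ r ▷ (p ◁ s ▷ t))              ∎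

  ◁▷-memory : ∀ p q r s t o →
    (p ◁ q ▷ (r ◁ s ▷ (t ◁ q ▷ o))) ≈ (p ◁ q ▷ (r ◁ s ▷ o))
  ◁▷-memory p q r s t o = ∨-congˡ (begin
    ¬ q ∧ (s ∧ r ∨ ¬ s ∧ (t ◁ q ▷ o))          ≈⟨ ∧-distribˡ _ _ _ ⟩
    ¬ q ∧ (s ∧ r) ∨ ¬ q ∧ (¬ s ∧ (t ◁ q ▷ o))  ≈⟨ ∨-congˡ (remember-F t q o (¬ s)) ⟩
    ¬ q ∧ (s ∧ r) ∨ ¬ q ∧ (¬ s ∧ o)            ≈⟨ ∧-distribˡ _ _ _ ⟨
    ¬ q ∧ (s ∧ r ∨ ¬ s ∧ o)                    ∎)

  -- Prefixing `guard q` splits the left side into the cases `q` and `¬ q`, and in each case both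
  -- inner tests of `q` are remembered.
  ◁▷-exchange : ∀ p q r s t o →
    ((p ◁ q ▷ r) ◁ s ▷ (t ◁ q ▷ o)) ≈ ((p ◁ s ▷ t) ◁ q ▷ (r ◁ s ▷ o))
  ◁▷-exchange p q r s t o = begin
    L                                    ≈⟨ guarded ⟨
    guard q ∧ L                          ≈⟨ guard-∧ q L ⟩
    q ∧ L ∨ ¬ q ∧ L                      ≈⟨ ∨-cong branch-T branch-F ⟩
    ((p ◁ s ▷ t) ◁ q ▷ (r ◁ s ▷ o))      ∎
    where
    m = p ◁ q ▷ r
    n = t ◁ q ▷ o
    L = m ◁ s ▷ n

    -- Both branches of `L` absorb `guard q`, but it stands before the test of `s`. Introducing
    -- `guard s` and commuting the two guards moves it into the branches.
    guarded : guard q ∧ L ≈ L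
    guarded = begin
      guard q ∧ L                                  ≈⟨ ∧-congˡ (guard-∧-◁▷ m s n) ⟨
      guard q ∧ (guard s ∧ L)                      ≈⟨ ∧-assoc _ _ _ ⟨
      (guard q ∧ guard s) ∧ L                      ≈⟨ ∧-congʳ (guard-comm q s) ⟩
      (guard s ∧ guard q) ∧ L                      ≈⟨ ∧-assoc _ _ _ ⟩
      guard s ∧ (guard q ∧ L)                      ≈⟨ guard-∧ s _ ⟩
      s ∧ (guard q ∧ L) ∨ ¬ s ∧ (guard q ∧ L)
        ≈⟨ ∨-cong (remember-T m s n _) (remember-F m s n _) ⟩
      s ∧ (guard q ∧ m) ∨ ¬ s ∧ (guard q ∧ n)
        ≈⟨ ∨-cong (∧-congˡ (guard-∧-◁▷ p q r)) (∧-congˡ (guard-∧-◁▷ t q o)) ⟩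
      s ∧ m ∨ ¬ s ∧ n                              ∎

    branch-T : q ∧ L ≈ q ∧ (p ◁ s ▷ t)
    branch-T = begin
      q ∧ (s ∧ m ∨ ¬ s ∧ n)          ≈⟨ ∧-distribˡ _ _ _ ⟩
      q ∧ (s ∧ m) ∨ q ∧ (¬ s ∧ n)    ≈⟨ ∨-cong (remember-T p q r s) (remember-T t q o (¬ s)) ⟩
      q ∧ (s ∧ p) ∨ q ∧ (¬ s ∧ t)    ≈⟨ ∧-distribˡ _ _ _ ⟨
      q ∧ (s ∧ p ∨ ¬ s ∧ t)          ∎

    branch-F : ¬ q ∧ L ≈ ¬ q ∧ (r ◁ s ▷ o)
    branch-F = begin
      ¬ q ∧ (s ∧ m ∨ ¬ s ∧ n)            ≈⟨ ∧-distribˡ _ _ _ ⟩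
      ¬ q ∧ (s ∧ m) ∨ ¬ q ∧ (¬ s ∧ n)    ≈⟨ ∨-cong (remember-F p q r s) (remember-F t q o (¬ s)) ⟩
      ¬ q ∧ (s ∧ r) ∨ ¬ q ∧ (¬ s ∧ o)    ≈⟨ ∧-distribˡ _ _ _ ⟨
      ¬ q ∧ (s ∧ r ∨ ¬ s ∧ o)            ∎

  -- Undefinedness enters only as a fixpoint of negation. Such a `p` is `p ∧ ¬ p`, hence `p ∧ F`,
  -- and `F` cuts off whatever follows.
  ∧-fixpoint : ∀ {p} → ¬ p ≈ p → ∀ q → p ∧ q ≈ p
  ∧-fixpoint {p} ¬p≈p q = begin
    p ∧ q        ≈⟨ ∧-congʳ p≈p∧F ⟩
    (p ∧ F) ∧ q  ≈⟨ ∧-assoc _ _ _ ⟩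
    p ∧ (F ∧ q)  ≈⟨ ∧-congˡ (∧-zeroˡ q) ⟩
    p ∧ F        ≈⟨ p≈p∧F ⟨
    p            ∎
    where
    p≈p∧F : p ≈ p ∧ F
    p≈p∧F = begin
      p        ≈⟨ ∧-idem p ⟨
      p ∧ p    ≈⟨ ∧-congˡ ¬p≈p ⟨
      p ∧ ¬ p  ≈⟨ ∧-¬ p ⟩
      p ∧ F    ∎

  ◁fixpoint▷ : ∀ {q} → ¬ q ≈ q → ∀ p r → (p ◁ q ▷ r) ≈ q
  ◁fixpoint▷ {q} ¬q≈q p r = begin
    q ∧ p ∨ ¬ q ∧ r  ≈⟨ ∨-cong (∧-fixpoint ¬q≈q p) (trans (∧-congʳ ¬q≈q) (∧-fixpoint ¬q≈q r)) ⟩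
    q ∨ q            ≈⟨ ∨-idem q ⟩
    q                ∎

-- Imported only here because its constructor names clash with the lemma names above.
open import Defs

-- Derivability as a setoid, and substitutions for instantiating axioms.

derivability : {Σ : Signature a} → Rel (Term Σ) ℓ → Setoid a (a ⊔ ℓ)
derivability E = record
  { _≈_           = E ⊢_≈_
  ; isEquivalence = record { refl = refl ; sym = sym ; trans = trans }
  }

-- The arguments follow the order of the axiom variables `x` to `w`; the default `o` serves `w` and
-- every later variable.
assign : {Σ : Signature a} (p q r s t o : Term Σ) → ℕ → Term Σ
assign p q r s t o 0 = p
assign p q r s t o 1 = q
assign p q r s t o 2 = r
assign p q r s t o 3 = s
assign p q r s t o 4 = t
assign p q r s t o _ = o

assign₁ : {Σ : Signature a} (p : Term Σ) → ℕ → Term Σ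
assign₁ p = assign p p p p p p

assign₂ : {Σ : Signature a} (p q : Term Σ) → ℕ → Term Σ
assign₂ p q = assign p q q q q q

assign₃ : {Σ : Signature a} (p q r : Term Σ) → ℕ → Term Σ
assign₃ p q r = assign p q r r r r

-- From the conditional theory to `CL₃`.

module _ {A : Set a} where

  -- The Lindenbaum algebra: an identity proved for every `CAlgebra` becomes a derivation in `CL₃`.
  termAlgebra : CAlgebra a a
  termAlgebra = record
    { isEquivalence = Setoid.isEquivalence (derivability (CL₃ {A = A}))
    ; _∧_           = _∧_
    ; _∨_           = _∨_
    ; ¬_            = ¬_
    ; T             = T
    ; F             = F
    ; ∧-cong        = λ e f → cong and (e ∷ f ∷ [])
    ; ∨-cong        = λ e f → cong or (e ∷ f ∷ [])
    ; ¬-cong        = λ e → cong not (e ∷ [])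
    ; ¬-involutive  = λ p → axiom ¬-invol (assign₁ p)
    ; ¬-∧           = λ p q → axiom deMorgan (assign₂ p q)
    ; ∧-assoc       = λ p q r → axiom ∧-assoc (assign₃ p q r)
    ; ∧-distribˡ    = λ p q r → axiom ∧-distˡ (assign₃ p q r)
    ; ∧-distribʳ    = λ p q r → axiom ∧-distʳ (assign₃ p q r)
    ; ∨-absorbs-∧   = λ p q → axiom ∨-absorb (assign₂ p q)
    ; ∧-∨-comm      = λ p q → axiom ∧∨-comm (assign₂ p q)
    ; ∧-identityˡ   = λ p → axiom T-∧ (assign₁ p)
    ; ¬T≈F          = axiom ¬T (assign₁ T)
    }
    where open SCLSyntax

  private
    module C = CAlgebra termAlgebra
    module D = Duality termAlgebra
    module P = Properties termAlgebra
    module I = Conditional termAlgebra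

  mutual
    unfold : Term (ΣCond A) → Term (ΣSCLᵁ A)
    unfold (var i)                    = var i
    unfold (op (scl f) ts)            = op f (unfold* ts)
    unfold (op cond (p ∷ q ∷ r ∷ [])) = unfold p I.◁ unfold q ▷ unfold r

    unfold* : ∀ {n} → Vec (Term (ΣCond A)) n → Vec (Term (ΣSCLᵁ A)) n
    unfold* []       = []
    unfold* (t ∷ ts) = unfold t ∷ unfold* ts

  mutual
    unfold-rename : ∀ t → unfold (rename scl t) ≡ t
    unfold-rename (var i)   = ≡.refl
    unfold-rename (op f ts) = ≡.cong (op f) (unfold*-rename* ts)

    unfold*-rename* : ∀ {n} (ts : Vec (Term (ΣSCLᵁ A)) n) → unfold* (rename* scl ts) ≡ ts
    unfold*-rename* []       = ≡.refl
    unfold*-rename* (t ∷ ts) = ≡.cong₂ _∷_ (unfold-rename t) (unfold*-rename* ts)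

  -- Substitution and `unfold` both compute on the concrete shape of an axiom, so each goal is an
  -- algebraic law at the terms `unfold (σ i)`.
  unfold-axiom : ∀ {s t} → CPclᵁ+Defs s t → (σ : ℕ → Term (ΣCond A)) →
                 CL₃ ⊢ unfold (s [ σ ]) ≈ unfold (t [ σ ])
  unfold-axiom (cpclᵁ (cpcl (cpmem (cp cond-T)))) σ = I.◁T▷ _ _
  unfold-axiom (cpclᵁ (cpcl (cpmem (cp cond-F)))) σ = I.◁F▷ _ _
  unfold-axiom (cpclᵁ (cpcl (cpmem (cp T-cond-F)))) σ = I.T◁▷F _
  unfold-axiom (cpclᵁ (cpcl (cpmem (cp cond-cond)))) σ = I.◁◁▷▷ _ _ _ _ _
  unfold-axiom (cpclᵁ (cpcl (cpmem mem))) σ = I.◁▷-memory _ _ _ _ _ _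
  unfold-axiom (cpclᵁ (cpcl cl)) σ = I.◁▷-exchange _ _ _ _ _ _
  -- The axiom `¬U` makes `U` a fixpoint of negation; it is closed, so any substitution, here `var`,
  -- will do.
  unfold-axiom (cpclᵁ cond-U) σ = I.◁fixpoint▷ (axiom ¬U var) _ _
  unfold-axiom ¬-def σ = sym (I.F◁▷T _)
  unfold-axiom ∧-def σ = sym (P.∨-¬∧F _ _)
  unfold-axiom F-def σ = sym C.¬T≈F
  unfold-axiom ∨-def σ = sym (trans (cong not (sym (D.¬-∨ _ _) ∷ [])) (C.¬-involutive _))

  mutual
    unfold-sound : ∀ {s t} → CPclᵁ+Defs ⊢ s ≈ t → CL₃ ⊢ unfold s ≈ unfold t
    unfold-sound (axiom e σ)                   = unfold-axiom e σ
    unfold-sound refl                          = refl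
    unfold-sound (sym d)                       = sym (unfold-sound d)
    unfold-sound (trans d e)                   = trans (unfold-sound d) (unfold-sound e)
    unfold-sound (cong (scl f) ds)             = cong f (unfold*-sound ds)
    unfold-sound (cong cond (d ∷ e ∷ f ∷ []))  =
      I.◁▷-cong (unfold-sound d) (unfold-sound e) (unfold-sound f)

    unfold*-sound : ∀ {n} {ss ts : Vec (Term (ΣCond A)) n} →
                    Pointwise (CPclᵁ+Defs ⊢_≈_) ss ts →
                    Pointwise (CL₃ ⊢_≈_) (unfold* ss) (unfold* ts)
    unfold*-sound []       = []
    unfold*-sound (d ∷ ds) = unfold-sound d ∷ unfold*-sound ds

-- From `CL₃` to the conditional theory.

module ConditionalTheory {A : Set a} where
  open CondSyntax
  open SetoidReasoning (derivability (CPclᵁ+Defs {A = A}))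

  infix 4 _≈_
  _≈_ : Rel (Term (ΣCond A)) a
  s ≈ t = CPclᵁ+Defs ⊢ s ≈ t

  private
    variable
      p p′ q q′ r r′ : Term (ΣCond A)

    CP⇒ : ∀ {s t} → CP s t → CPclᵁ+Defs {A = A} s t
    CP⇒ e = cpclᵁ (cpcl (cpmem (cp e)))

  ◁▷-cong : p ≈ p′ → q ≈ q′ → r ≈ r′ → (p ◁ q ▷ r) ≈ (p′ ◁ q′ ▷ r′)
  ◁▷-cong d e f = cong cond (d ∷ e ∷ f ∷ [])

  ◁▷-congˡ : p ≈ p′ → (p ◁ q ▷ r) ≈ (p′ ◁ q ▷ r)
  ◁▷-congˡ e = ◁▷-cong e refl refl

  ◁▷-congᶜ : q ≈ q′ → (p ◁ q ▷ r) ≈ (p ◁ q′ ▷ r)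
  ◁▷-congᶜ e = ◁▷-cong refl e refl

  ◁▷-congʳ : r ≈ r′ → (p ◁ q ▷ r) ≈ (p ◁ q ▷ r′)
  ◁▷-congʳ = ◁▷-cong refl refl

  ◁T▷ : ∀ p q → (p ◁ T ▷ q) ≈ p
  ◁T▷ p q = axiom (CP⇒ cond-T) (assign₂ p q)

  ◁F▷ : ∀ p q → (p ◁ F ▷ q) ≈ q
  ◁F▷ p q = axiom (CP⇒ cond-F) (assign₂ p q)

  T◁▷F : ∀ p → (T ◁ p ▷ F) ≈ p
  T◁▷F p = axiom (CP⇒ T-cond-F) (assign₁ p)

  ◁◁▷▷ : ∀ p q r s t → (p ◁ (q ◁ r ▷ s) ▷ t) ≈ ((p ◁ q ▷ t) ◁ r ▷ (p ◁ s ▷ t))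
  ◁◁▷▷ p q r s t = axiom (CP⇒ cond-cond) (assign p q r s t t)

  ◁▷-exchange : ∀ p q r s t o →
    ((p ◁ q ▷ r) ◁ s ▷ (t ◁ q ▷ o)) ≈ ((p ◁ s ▷ t) ◁ q ▷ (r ◁ s ▷ o))
  ◁▷-exchange p q r s t o = axiom (cpclᵁ (cpcl cl)) (assign p q r s t o)

  ¬-◁▷ : ∀ p → ¬ p ≈ (F ◁ p ▷ T)
  ¬-◁▷ p = axiom ¬-def (assign₁ p)

  ∧-◁▷ : ∀ p q → p ∧ q ≈ (q ◁ p ▷ F)
  ∧-◁▷ p q = axiom ∧-def (assign₂ p q)

  ◁¬▷ : ∀ p q r → (p ◁ ¬ q ▷ r) ≈ (r ◁ q ▷ p)
  ◁¬▷ p q r = begin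
    (p ◁ ¬ q ▷ r)                  ≈⟨ ◁▷-congᶜ (¬-◁▷ q) ⟩
    (p ◁ (F ◁ q ▷ T) ▷ r)          ≈⟨ ◁◁▷▷ p F q T r ⟩
    ((p ◁ F ▷ r) ◁ q ▷ (p ◁ T ▷ r)) ≈⟨ ◁▷-cong (◁F▷ p r) refl (◁T▷ p r) ⟩
    (r ◁ q ▷ p)                    ∎

  ◁∧▷ : ∀ p q r s → (p ◁ q ∧ r ▷ s) ≈ ((p ◁ r ▷ s) ◁ q ▷ s)
  ◁∧▷ p q r s = begin
    (p ◁ q ∧ r ▷ s)                  ≈⟨ ◁▷-congᶜ (∧-◁▷ q r) ⟩
    (p ◁ (r ◁ q ▷ F) ▷ s)            ≈⟨ ◁◁▷▷ p r q F s ⟩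
    ((p ◁ r ▷ s) ◁ q ▷ (p ◁ F ▷ s))  ≈⟨ ◁▷-congʳ (◁F▷ p s) ⟩
    ((p ◁ r ▷ s) ◁ q ▷ s)            ∎

  ∨-◁▷ : ∀ p q → p ∨ q ≈ (T ◁ p ▷ q)
  ∨-◁▷ p q = begin
    p ∨ q                      ≈⟨ axiom ∨-def (assign₂ p q) ⟩
    ¬ (¬ p ∧ ¬ q)              ≈⟨ ¬-◁▷ _ ⟩
    (F ◁ ¬ p ∧ ¬ q ▷ T)        ≈⟨ ◁∧▷ _ _ _ _ ⟩
    ((F ◁ ¬ q ▷ T) ◁ ¬ p ▷ T)  ≈⟨ ◁¬▷ _ _ _ ⟩
    (T ◁ p ▷ (F ◁ ¬ q ▷ T))    ≈⟨ ◁▷-congʳ (◁¬▷ F q T) ⟩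
    (T ◁ p ▷ (T ◁ q ▷ F))      ≈⟨ ◁▷-congʳ (T◁▷F q) ⟩
    (T ◁ p ▷ q)                ∎

  ◁∨▷ : ∀ p q r s → (p ◁ q ∨ r ▷ s) ≈ (p ◁ q ▷ (p ◁ r ▷ s))
  ◁∨▷ p q r s = begin
    (p ◁ q ∨ r ▷ s)                  ≈⟨ ◁▷-congᶜ (∨-◁▷ q r) ⟩
    (p ◁ (T ◁ q ▷ r) ▷ s)            ≈⟨ ◁◁▷▷ p T q r s ⟩
    ((p ◁ T ▷ s) ◁ q ▷ (p ◁ r ▷ s))  ≈⟨ ◁▷-congˡ (◁T▷ p s) ⟩
    (p ◁ q ▷ (p ◁ r ▷ s))            ∎

  memory-F : ∀ p q r s t o → (p ◁ q ▷ (r ◁ s ▷ (t ◁ q ▷ o))) ≈ (p ◁ q ▷ (r ◁ s ▷ o))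
  memory-F p q r s t o = axiom (cpclᵁ (cpcl (cpmem mem))) (assign p q r s t o)

  -- The axiom `mem` remembers a test that failed; negating `q` turns success into failure.
  memory-T : ∀ p q r s t o → ((p ◁ s ▷ (t ◁ q ▷ o)) ◁ q ▷ r) ≈ ((p ◁ s ▷ t) ◁ q ▷ r)
  memory-T p q r s t o = begin
    ((p ◁ s ▷ (t ◁ q ▷ o)) ◁ q ▷ r)        ≈⟨ ◁¬▷ _ _ _ ⟨
    (r ◁ ¬ q ▷ (p ◁ s ▷ (t ◁ q ▷ o)))      ≈⟨ ◁▷-congʳ (◁▷-congʳ (◁¬▷ o q t)) ⟨
    (r ◁ ¬ q ▷ (p ◁ s ▷ (o ◁ ¬ q ▷ t)))    ≈⟨ memory-F r (¬ q) p s o t ⟩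
    (r ◁ ¬ q ▷ (p ◁ s ▷ t))                ≈⟨ ◁¬▷ _ _ _ ⟩
    ((p ◁ s ▷ t) ◁ q ▷ r)                  ∎

  repeat-F : ∀ p q r s → (p ◁ q ▷ (r ◁ q ▷ s)) ≈ (p ◁ q ▷ s)
  repeat-F p q r s = begin
    -- A dummy test of `F` supplies the intermediate test that `mem` expects.
    (p ◁ q ▷ (r ◁ q ▷ s))            ≈⟨ ◁▷-congʳ (◁F▷ p _) ⟨
    (p ◁ q ▷ (p ◁ F ▷ (r ◁ q ▷ s)))  ≈⟨ memory-F p q p F r s ⟩
    (p ◁ q ▷ (p ◁ F ▷ s))            ≈⟨ ◁▷-congʳ (◁F▷ p s) ⟩
    (p ◁ q ▷ s)                      ∎

  -- Here the repeated test lies in the first branch of the inner test; negating `s` moves it to the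
  -- branch that `mem` covers.
  memory-F′ : ∀ p q r s t o → (p ◁ q ▷ ((t ◁ q ▷ o) ◁ s ▷ r)) ≈ (p ◁ q ▷ (o ◁ s ▷ r))
  memory-F′ p q r s t o = begin
    (p ◁ q ▷ ((t ◁ q ▷ o) ◁ s ▷ r))    ≈⟨ ◁▷-congʳ (◁¬▷ r s _) ⟨
    (p ◁ q ▷ (r ◁ ¬ s ▷ (t ◁ q ▷ o)))  ≈⟨ memory-F p q r (¬ s) t o ⟩
    (p ◁ q ▷ (r ◁ ¬ s ▷ o))            ≈⟨ ◁▷-congʳ (◁¬▷ r s o) ⟩
    (p ◁ q ▷ (o ◁ s ▷ r))              ∎

  ¬¬-elim : ∀ p → ¬ ¬ p ≈ p
  ¬¬-elim p = begin
    ¬ ¬ p          ≈⟨ ¬-◁▷ (¬ p) ⟩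
    (F ◁ ¬ p ▷ T)  ≈⟨ ◁¬▷ F p T ⟩
    (T ◁ p ▷ F)    ≈⟨ T◁▷F p ⟩
    p              ∎

  ¬-∧ : ∀ p q → ¬ (p ∧ q) ≈ ¬ p ∨ ¬ q
  ¬-∧ p q = begin
    ¬ (p ∧ q)            ≈⟨ ¬-◁▷ _ ⟩
    (F ◁ p ∧ q ▷ T)      ≈⟨ ◁∧▷ _ _ _ _ ⟩
    ((F ◁ q ▷ T) ◁ p ▷ T) ≈⟨ ◁▷-congˡ (¬-◁▷ q) ⟨
    (¬ q ◁ p ▷ T)        ≈⟨ ◁¬▷ T p (¬ q) ⟨
    (T ◁ ¬ p ▷ ¬ q)      ≈⟨ ∨-◁▷ _ _ ⟨
    ¬ p ∨ ¬ q            ∎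

  ∧-associative : ∀ p q r → (p ∧ q) ∧ r ≈ p ∧ (q ∧ r)
  ∧-associative p q r = begin
    (p ∧ q) ∧ r            ≈⟨ ∧-◁▷ _ _ ⟩
    (r ◁ p ∧ q ▷ F)        ≈⟨ ◁∧▷ _ _ _ _ ⟩
    ((r ◁ q ▷ F) ◁ p ▷ F)  ≈⟨ ◁▷-congˡ (∧-◁▷ q r) ⟨
    (q ∧ r ◁ p ▷ F)        ≈⟨ ∧-◁▷ _ _ ⟨
    p ∧ (q ∧ r)            ∎

  ∧-distribˡ : ∀ p q r → p ∧ (q ∨ r) ≈ (p ∧ q) ∨ (p ∧ r)
  ∧-distribˡ p q r = begin
    p ∧ (q ∨ r)                                ≈⟨ ∧-◁▷ _ _ ⟩
    (q ∨ r ◁ p ▷ F)                            ≈⟨ ◁▷-congˡ (∨-◁▷ q r) ⟩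
    -- To fold `p ∧ q` back into a single test, `◁∧▷` needs the same term in both failure branches.
    -- The two memory laws, used backwards, plant `r ◁ p ▷ F`, that is `p ∧ r`, in each.
    ((T ◁ q ▷ r) ◁ p ▷ F)                      ≈⟨ repeat-F _ p r F ⟨
    ((T ◁ q ▷ r) ◁ p ▷ (r ◁ p ▷ F))            ≈⟨ memory-T T p _ q r F ⟨
    ((T ◁ q ▷ (r ◁ p ▷ F)) ◁ p ▷ (r ◁ p ▷ F))  ≈⟨ ◁∧▷ _ _ _ _ ⟨
    (T ◁ p ∧ q ▷ (r ◁ p ▷ F))                  ≈⟨ ◁▷-congʳ (∧-◁▷ p r) ⟨
    (T ◁ p ∧ q ▷ p ∧ r)                        ≈⟨ ∨-◁▷ _ _ ⟨
    (p ∧ q) ∨ (p ∧ r)                          ∎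

  ∧-distribʳ : ∀ p q r → (p ∨ q) ∧ r ≈ (p ∧ r) ∨ (¬ p ∧ (q ∧ r))
  ∧-distribʳ p q r = begin
    (p ∨ q) ∧ r                                ≈⟨ ∧-◁▷ _ _ ⟩
    (r ◁ p ∨ q ▷ F)                            ≈⟨ ◁∨▷ _ _ _ _ ⟩
    -- Writing `r` as `T ◁ r ▷ F` opens a failure branch, where `F ◁ p ▷ q ∧ r`, that is
    -- `¬ p ∧ (q ∧ r)`, can be planted.
    (r ◁ p ▷ (r ◁ q ▷ F))                      ≈⟨ ◁▷-cong (sym (T◁▷F r)) refl (sym (∧-◁▷ q r)) ⟩
    ((T ◁ r ▷ F) ◁ p ▷ q ∧ r)                  ≈⟨ memory-T T p _ r F (q ∧ r) ⟨
    ((T ◁ r ▷ (F ◁ p ▷ q ∧ r)) ◁ p ▷ q ∧ r)    ≈⟨ repeat-F _ p F (q ∧ r) ⟨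
    ((T ◁ r ▷ (F ◁ p ▷ q ∧ r)) ◁ p ▷ (F ◁ p ▷ q ∧ r))
      ≈⟨ ◁∧▷ _ _ _ _ ⟨
    (T ◁ p ∧ r ▷ (F ◁ p ▷ q ∧ r))              ≈⟨ ◁▷-congʳ (◁¬▷ _ _ _) ⟨
    (T ◁ p ∧ r ▷ (q ∧ r ◁ ¬ p ▷ F))            ≈⟨ ◁▷-congʳ (∧-◁▷ (¬ p) (q ∧ r)) ⟨
    (T ◁ p ∧ r ▷ ¬ p ∧ (q ∧ r))                ≈⟨ ∨-◁▷ _ _ ⟨
    (p ∧ r) ∨ (¬ p ∧ (q ∧ r))                  ∎

  ∨-absorbs-∧ : ∀ p q → p ∨ (p ∧ q) ≈ p
  ∨-absorbs-∧ p q = begin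
    p ∨ (p ∧ q)            ≈⟨ ∨-◁▷ _ _ ⟩
    (T ◁ p ▷ p ∧ q)        ≈⟨ ◁▷-congʳ (∧-◁▷ p q) ⟩
    (T ◁ p ▷ (q ◁ p ▷ F))  ≈⟨ repeat-F T p q F ⟩
    (T ◁ p ▷ F)            ≈⟨ T◁▷F p ⟩
    p                      ∎

  -- Each side normalises to one test with the other test in both of its branches. The axiom `cl`
  -- exchanges outer and inner tests, and memory tidies the leaves.
  ∧-∨-comm : ∀ p q → (p ∧ q) ∨ (q ∧ p) ≈ (q ∧ p) ∨ (p ∧ q)
  ∧-∨-comm p q = begin
    (p ∧ q) ∨ (q ∧ p)                          ≈⟨ normal p q ⟩
    ((T ◁ q ▷ F) ◁ p ▷ (p ◁ q ▷ F))            ≈⟨ ◁▷-exchange _ _ _ _ _ _ ⟩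
    ((T ◁ p ▷ p) ◁ q ▷ (F ◁ p ▷ F))            ≈⟨ ◁▷-congˡ (◁▷-congʳ (T◁▷F p)) ⟨
    ((T ◁ p ▷ (T ◁ p ▷ F)) ◁ q ▷ (F ◁ p ▷ F))  ≈⟨ ◁▷-congˡ (repeat-F T p T F) ⟩
    -- Where `q` has failed, `F` may be replaced by `T ◁ q ▷ F`, that is by `q`.
    ((T ◁ p ▷ F) ◁ q ▷ (F ◁ p ▷ F))            ≈⟨ memory-F′ _ q F p T F ⟨
    ((T ◁ p ▷ F) ◁ q ▷ ((T ◁ q ▷ F) ◁ p ▷ F))  ≈⟨ ◁▷-congʳ (◁▷-congˡ (T◁▷F q)) ⟩
    ((T ◁ p ▷ F) ◁ q ▷ (q ◁ p ▷ F))            ≈⟨ normal q p ⟨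
    (q ∧ p) ∨ (p ∧ q)                          ∎
    where
    normal : ∀ p q → (p ∧ q) ∨ (q ∧ p) ≈ ((T ◁ q ▷ F) ◁ p ▷ (p ◁ q ▷ F))
    normal p q = begin
      (p ∧ q) ∨ (q ∧ p)                          ≈⟨ ∨-◁▷ _ _ ⟩
      (T ◁ p ∧ q ▷ q ∧ p)                        ≈⟨ ◁∧▷ _ _ _ _ ⟩
      ((T ◁ q ▷ q ∧ p) ◁ p ▷ q ∧ p)              ≈⟨ ◁▷-cong (◁▷-congʳ (∧-◁▷ q p)) refl (∧-◁▷ q p) ⟩
      ((T ◁ q ▷ (p ◁ q ▷ F)) ◁ p ▷ (p ◁ q ▷ F))  ≈⟨ ◁▷-congˡ (repeat-F T q p F) ⟩
      ((T ◁ q ▷ F) ◁ p ▷ (p ◁ q ▷ F))            ∎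

  ∧-identityˡ : ∀ p → T ∧ p ≈ p
  ∧-identityˡ p = trans (∧-◁▷ T p) (◁T▷ p F)

  ¬U≈U : ¬ U ≈ U
  ¬U≈U = trans (¬-◁▷ U) (axiom (cpclᵁ cond-U) (assign₂ F T))

  rename-axiom : ∀ {s t} → CL₃ s t → (σ : ℕ → Term (ΣSCLᵁ A)) →
                 rename scl (s [ σ ]) ≈ rename scl (t [ σ ])
  rename-axiom ¬-invol  σ = ¬¬-elim _
  rename-axiom deMorgan σ = ¬-∧ _ _
  rename-axiom ∧-assoc  σ = ∧-associative _ _ _
  rename-axiom ∧-distˡ  σ = ∧-distribˡ _ _ _
  rename-axiom ∧-distʳ  σ = ∧-distribʳ _ _ _
  rename-axiom ∨-absorb σ = ∨-absorbs-∧ _ _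
  rename-axiom ∧∨-comm  σ = ∧-∨-comm _ _
  rename-axiom T-∧      σ = ∧-identityˡ _
  rename-axiom ¬T       σ = sym (axiom F-def var)
  rename-axiom ¬U       σ = ¬U≈U

  mutual
    rename-sound : ∀ {s t} → CL₃ ⊢ s ≈ t → rename scl s ≈ rename scl t
    rename-sound (axiom e σ) = rename-axiom e σ
    rename-sound refl        = refl
    rename-sound (sym d)     = sym (rename-sound d)
    rename-sound (trans d e) = trans (rename-sound d) (rename-sound e)
    rename-sound (cong f ds) = cong (scl f) (rename*-sound ds)

    rename*-sound : ∀ {n} {ss ts : Vec (Term (ΣSCLᵁ A)) n} → Pointwise (CL₃ ⊢_≈_) ss ts →
                    Pointwise (CPclᵁ+Defs ⊢_≈_) (rename* scl ss) (rename* scl ts)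
    rename*-sound []       = []
    rename*-sound (d ∷ ds) = rename-sound d ∷ rename*-sound ds

theorem4p10 : {a : Level} (A : Set a) (s t : Term (ΣSCLᵁ A)) →
    (CL₃ ⊢ s ≈ t) ⇔ (CℓSCL⊢ s ≈ t)
theorem4p10 A s t = mk⇔ ConditionalTheory.rename-sound λ d →
  -- Terms free of conditionals survive the round trip unchanged, so the translated derivation
  -- proves `s ≈ t` itself.
  ≡.subst₂ (CL₃ ⊢_≈_) (unfold-rename s) (unfold-rename t) (unfold-sound d)
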